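{- Let $V$ be a quasivariety. If $Y$ is a presentation of a point $X\in V$, then $X \le_e Y$. More precisely, there exists a computable function $f$, depending only on $V$, such that for all $X\in V$ and $Y\subseteq I$: $X\le_e^f Y$ if and only if $Y$ is a presentation of $X$. In particular, every finitely presented or recursively presented point of $V$ is a recursively enumerable subset of $I$.
   Context: $I$ is a computable countable set identified with $\mathbb{N}$. A quasivariety $V$ is given by a recursively enumerable set $S$ of finite sequences $(n_0,\dots,n_k)$ of elements of $I$: $V$ is the set of all $X\subseteq I$ such that for every $(n_0,\dots,n_k)\in S$, if $n_1,\dots,n_k\in X$ then $n_0\in X$. Elements of $V$ are called points. $V$ contains $I$ and is closed under arbitrary intersections, so every $Y\subseteq I$ is contained in a smallest point of $V$. A presentation of $X\in V$ is a set $Y\subseteq I$ such that $X$ is the smallest point of $V$ containing $Y$; $X$ is finitely (resp. recursively) presented if it has a finite (resp. recursively enumerable) presentation. Enumeration reducibility: for $A,B\subseteq I$ and a computable $f: I\times\mathbb{N}\to P_f(I)\cup\{\{\bot\}\}$ (where $P_f(I)$ is a recursive encoding of the finite subsets of $I$ and $\bot\notin I$), write $A\le_e^f B$ if for all $x\in I$: $x\in A \iff \exists n,\ f(x,n)\subseteq B$. Write $A\le_e B$ if $A\le_e^f B$ for some such computable $f$. -}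

module Defs where

open import Data.Nat using (ℕ)
open import Data.List using (List)
open import Data.List.Relation.Unary.All using (All)
open import Data.List.Membership.Propositional using (_∈_)
open import Data.Maybe using (Maybe; just; nothing)
open import Data.Product using (_×_; ∃; Σ; _,_)
open import Data.Empty using (⊥)
open import Relation.Binary.PropositionalEquality using (_≡_)
open import Function.Bundles using (_⇔_)

-- I is identified with ℕ; subsets of I are predicates on ℕ.
Subset : Set₁
Subset = ℕ → Set

_⊆_ : Subset → Subset → Set
A ⊆ B = ∀ x → A x → B x

-- A quasivariety is given by a recursively enumerable set S of finite
-- sequences (n₀, n₁, …, n_k), k ≥ 0.  A sequence is encoded as the pair
-- (n₀ , [n₁ … n_k]).  An r.e. set S is given by an enumeration
-- e : ℕ → Maybe (ℕ × List ℕ) (nothing = "no element at this stage",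
-- allowing S = ∅); S = { s | ∃ m, e m ≡ just s }.
Enumeration : Set
Enumeration = ℕ → Maybe (ℕ × List ℕ)

InS : Enumeration → ℕ × List ℕ → Set
InS e s = ∃ λ m → e m ≡ just s

IsPoint : Enumeration → Subset → Set
IsPoint e X = ∀ n₀ ns → InS e (n₀ , ns) → All X ns → X n₀

IsPresentation : Enumeration → Subset → Subset → Set₁
IsPresentation e X Y =
  IsPoint e X × Y ⊆ X × (∀ (Z : Subset) → IsPoint e Z → Y ⊆ Z → X ⊆ Z)

-- Values of the reduction function: just F encodes a finite subset F of I
-- (as a list), nothing encodes {⊥}, which is never contained in a subset of I.
_⊆ᶠ_ : Maybe (List ℕ) → Subset → Set
just l  ⊆ᶠ B = All B l
nothing ⊆ᶠ B = ⊥

_≤e[_]_ : Subset → (ℕ → ℕ → Maybe (List ℕ)) → Subset → Set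
A ≤e[ f ] B = ∀ x → A x ⇔ (∃ λ n → f x n ⊆ᶠ B)

FinitelyPresented : Enumeration → Subset → Set₁
FinitelyPresented e X = Σ (List ℕ) λ l → IsPresentation e X (λ y → y ∈ l)

RecEnum : Subset → Set
RecEnum B = Σ (ℕ → Maybe ℕ) λ g → ∀ x → B x ⇔ (∃ λ n → g n ≡ just x)

RecursivelyPresented : Enumeration → Subset → Set₁
RecursivelyPresented e X =
  Σ (ℕ → Maybe ℕ) λ g → IsPresentation e X (λ y → ∃ λ n → g n ≡ just y)

module Submission where

-- The smallest point containing Y is the set of x derivable from Y, i.e.
-- lying in the closure of some finite H ⊆ Y under finitely many rules of S.
-- Coding derivations (H, rules) by natural numbers n, let f(x, n) be H if the
-- derivation coded by n yields x, and {⊥} otherwise.  Then X ≤ₑᶠ Y says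
-- precisely that X is the set derivable from Y.  As f is computable, a set
-- enumeration-reducible to an r.e. set (in particular to a finite one) is r.e.

open import Defs
open import Data.Nat using (ℕ; zero; suc; _≟_)
open import Data.List using (List; []; _∷_; _++_; [_]; head; drop)
open import Data.Maybe using (Maybe; just; nothing)
open import Data.Product using (_×_; Σ; _,_; proj₁; proj₂; ∃; ∃₂)
open import Function.Bundles using (_⇔_; mk⇔; Equivalence)
open import Data.Nat.Binary as ℕᵇ using (ℕᵇ; 2[1+_]; 1+[2_])
open import Data.Nat.Binary.Properties using (fromℕ-toℕ)
open import Data.List.Membership.Propositional using (_∈_)
open import Data.List.Membership.DecPropositional _≟_ using (_∈?_)
open import Data.List.Relation.Unary.All as All using (All; []; _∷_; all?)
open import Data.List.Relation.Unary.All.Properties using (++⁺)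
open import Data.List.Relation.Unary.Any using (here; there)
open import Data.List.Relation.Binary.Pointwise as Pointwise using (Pointwise; []; _∷_)
open import Data.List.Relation.Binary.Subset.Propositional using () renaming (_⊆_ to _⊆ˡ_)
open import Data.List.Relation.Binary.Subset.Propositional.Properties
  using (⊆-refl; ⊆-trans; ∷⁺ʳ; xs⊆x∷xs; xs⊆xs++ys; xs⊆ys++xs)
open import Data.Maybe.Properties using () renaming (≡-dec to ≡-decMaybe)
open import Data.Empty using (⊥; ⊥-elim)
open import Function using (_∘_; id)
open import Function.Construct.Composition using (_⇔-∘_)
open import Function.Construct.Symmetry using (⇔-sym)
open import Function.Construct.Identity using (⇔-id)
open import Relation.Nullary using (Dec; yes; no; contradiction)
open import Relation.Binary.PropositionalEquality using (_≡_; refl; sym; trans; cong; cong₂; subst)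

record Coding (A : Set) : Set where
  field
    decode        : ℕ → A
    encode        : A → ℕ
    decode-encode : ∀ a → decode (encode a) ≡ a

ℕ-coding : Coding ℕ
ℕ-coding = record { decode = id ; encode = id ; decode-encode = λ _ → refl }

-- Read in binary, an odd digit pushes a 0 onto the list and a nonzero even
-- digit increments its head.
incrementHead : List ℕ → List ℕ
incrementHead []       = []
incrementHead (x ∷ xs) = suc x ∷ xs

decodeᵇ : ℕᵇ → List ℕ
decodeᵇ ℕᵇ.zero   = []
decodeᵇ 1+[2 b ]  = 0 ∷ decodeᵇ b
decodeᵇ 2[1+ b ]  = incrementHead (decodeᵇ b)

encodeᵇ : List ℕ → ℕᵇ
encodeᵇ []           = ℕᵇ.zero
encodeᵇ (zero ∷ xs)  = 1+[2 encodeᵇ xs ]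
encodeᵇ (suc x ∷ xs) = 2[1+ encodeᵇ (x ∷ xs) ]

decodeᵇ-encodeᵇ : ∀ xs → decodeᵇ (encodeᵇ xs) ≡ xs
decodeᵇ-encodeᵇ []           = refl
decodeᵇ-encodeᵇ (zero ∷ xs)  = cong (0 ∷_) (decodeᵇ-encodeᵇ xs)
decodeᵇ-encodeᵇ (suc x ∷ xs) = cong incrementHead (decodeᵇ-encodeᵇ (x ∷ xs))

List-coding : Coding (List ℕ)
List-coding = record
  { decode        = decodeᵇ ∘ ℕᵇ.fromℕ
  ; encode        = ℕᵇ.toℕ ∘ encodeᵇ
  ; decode-encode = decode-encode
  }
  where
  decode-encode : ∀ xs → decodeᵇ (ℕᵇ.fromℕ (ℕᵇ.toℕ (encodeᵇ xs))) ≡ xs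
  decode-encode xs rewrite fromℕ-toℕ (encodeᵇ xs) = decodeᵇ-encodeᵇ xs

×-coding : ∀ {A B} → Coding A → Coding B → Coding (A × B)
×-coding {A} {B} cA cB = record
  { decode        = decodePair ∘ Coding.decode List-coding
  ; encode        = λ (a , b) → Coding.encode List-coding (A.encode a ∷ B.encode b ∷ [])
  ; decode-encode = decode-encode
  }
  where
  module A = Coding cA
  module B = Coding cB

  decodePair : List ℕ → A × B
  decodePair (i ∷ j ∷ _) = A.decode i , B.decode j
  decodePair _           = A.decode 0 , B.decode 0

  decode-encode : ∀ p → decodePair (Coding.decode List-coding
                    (Coding.encode List-coding (A.encode (proj₁ p) ∷ B.encode (proj₂ p) ∷ []))) ≡ p
  decode-encode (a , b)
    rewrite Coding.decode-encode List-coding (A.encode a ∷ B.encode b ∷ [])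
    = cong₂ _,_ (A.decode-encode a) (B.decode-encode b)

RecEnum-∃ : ∀ {A} → Coding A → (X : Subset) (P : ℕ → A → Set) →
            (∀ x a → Dec (P x a)) → (∀ x → X x ⇔ ∃ (P x)) → RecEnum X
RecEnum-∃ {A} cA X P P? X⇔∃P = accept ∘ decode , λ x → mk⇔ (enumerated x) (member x)
  where
  open Coding (×-coding ℕ-coding cA)

  accept : ℕ × A → Maybe ℕ
  accept (x , a) with P? x a
  ... | yes _ = just x
  ... | no  _ = nothing

  accept-complete : ∀ x a → P x a → accept (x , a) ≡ just x
  accept-complete x a p with P? x a
  ... | yes _ = refl
  ... | no ¬p = contradiction p ¬p

  accept-sound : ∀ x a y → accept (x , a) ≡ just y → ∃ (P y)
  accept-sound x a y eq with P? x a | eq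
  ... | yes p | refl = a , p

  enumerated : ∀ x → X x → ∃ λ k → accept (decode k) ≡ just x
  enumerated x Xx with Equivalence.to (X⇔∃P x) Xx
  ... | a , p = encode (x , a) , trans (cong accept (decode-encode (x , a))) (accept-complete x a p)

  member : ∀ x → (∃ λ k → accept (decode k) ≡ just x) → X x
  member x (k , eq) = Equivalence.from (X⇔∃P x) (accept-sound _ _ x eq)

RecEnum-∈ : (l : List ℕ) → RecEnum (_∈ l)
RecEnum-∈ l = (λ n → head (drop n l)) , λ x → mk⇔ (enumerated l) (member l)
  where
  enumerated : ∀ {x} l → x ∈ l → ∃ λ n → head (drop n l) ≡ just x
  enumerated (y ∷ l) (here refl) = 0 , refl
  enumerated (y ∷ l) (there x∈l) with enumerated l x∈l
  ... | n , eq = suc n , eq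

  member : ∀ {x} l → (∃ λ n → head (drop n l) ≡ just x) → x ∈ l
  member (y ∷ l) (zero  , refl) = here refl
  member (y ∷ l) (suc n , eq)   = there (member l (n , eq))

All⇔∃-Pointwise : ∀ {A J : Set} {B : A → Set} {R : J → A → Set} →
                  (∀ y → B y ⇔ ∃ λ j → R j y) →
                  ∀ l → All B l ⇔ ∃ λ js → Pointwise R js l
All⇔∃-Pointwise {B = B} {R} B⇔∃R l = mk⇔ (witnesses l) (from l)
  where
  witnesses : ∀ l → All B l → ∃ λ js → Pointwise R js l
  witnesses [] [] = [] , []
  witnesses (y ∷ l) (By ∷ Bl) with Equivalence.to (B⇔∃R y) By | witnesses l Bl
  ... | j , Rjy | js , Rjsl = j ∷ js , Rjy ∷ Rjsl

  from : ∀ l → (∃ λ js → Pointwise R js l) → All B l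
  from [] _ = []
  from (y ∷ l) (j ∷ js , Rjy ∷ Rjsl) = Equivalence.from (B⇔∃R y) (j , Rjy) ∷ from l (js , Rjsl)

WitnessedBy : (ℕ → Maybe ℕ) → Maybe (List ℕ) → List ℕ → Set
WitnessedBy g (just l) js = Pointwise (λ j y → g j ≡ just y) js l
WitnessedBy g nothing  js = ⊥

≤e-RecEnum : ∀ {A f B} → A ≤e[ f ] B → RecEnum B → RecEnum A
≤e-RecEnum {A} {f} {B} A≤B (g , B⇔g) =
  RecEnum-∃ (×-coding ℕ-coding List-coding) A
    (λ x (n , js) → WitnessedBy g (f x n) js)
    (λ x (n , js) → witnessedBy? (f x n) js)
    A⇔∃WitnessedBy
  where
  witnessedBy? : ∀ m js → Dec (WitnessedBy g m js)
  witnessedBy? (just l) js = Pointwise.decidable (λ j y → ≡-decMaybe _≟_ (g j) (just y)) js l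
  witnessedBy? nothing  js = no id

  ⊆ᶠ⇔∃WitnessedBy : ∀ m → m ⊆ᶠ B ⇔ ∃ (WitnessedBy g m)
  ⊆ᶠ⇔∃WitnessedBy (just l) = All⇔∃-Pointwise B⇔g l
  ⊆ᶠ⇔∃WitnessedBy nothing  = mk⇔ ⊥-elim (⊥-elim ∘ proj₂)

  A⇔∃WitnessedBy : ∀ x → A x ⇔ ∃ λ ((n , js) : ℕ × List ℕ) → WitnessedBy g (f x n) js
  A⇔∃WitnessedBy x = mk⇔
    (λ Ax → let n , fxn⊆B = Equivalence.to (A≤B x) Ax
                js , w    = Equivalence.to (⊆ᶠ⇔∃WitnessedBy (f x n)) fxn⊆B
            in (n , js) , w)
    (λ ((n , js) , w) → Equivalence.from (A≤B x) (n , Equivalence.from (⊆ᶠ⇔∃WitnessedBy (f x n)) (js , w)))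

IsPresentation⇔≐ : ∀ {e W X Y} → IsPresentation e W Y → IsPoint e X →
                   IsPresentation e X Y ⇔ (∀ x → X x ⇔ W x)
IsPresentation⇔≐ {e} {W} {X} {Y} (W-point , Y⊆W , W-least) X-point = mk⇔ to from
  where
  to : IsPresentation e X Y → ∀ x → X x ⇔ W x
  to (_ , Y⊆X , X-least) x = mk⇔ (X-least W W-point Y⊆W x) (W-least X X-point Y⊆X x)

  from : (∀ x → X x ⇔ W x) → IsPresentation e X Y
  from X≐W = X-point
           , (λ y Yy → Equivalence.from (X≐W y) (Y⊆W y Yy))
           , (λ Z Z-point Y⊆Z x Xx → W-least Z Z-point Y⊆Z x (Equivalence.to (X≐W x) Xx))

module Derivations (e : Enumeration) where

  -- Rules are fired in order, and one whose premises are not yet available is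
  -- skipped, so that every list of rule indices is a derivation.
  fire : Maybe (ℕ × List ℕ) → List ℕ → List ℕ
  fire nothing          D = D
  fire (just (n₀ , ns)) D with all? (_∈? D) ns
  ... | yes _ = n₀ ∷ D
  ... | no  _ = D

  fire-⊇ : ∀ r D → D ⊆ˡ fire r D
  fire-⊇ nothing          D = ⊆-refl
  fire-⊇ (just (n₀ , ns)) D with all? (_∈? D) ns
  ... | yes _ = xs⊆x∷xs D n₀
  ... | no  _ = ⊆-refl

  fire-mono : ∀ r {D D′} → D ⊆ˡ D′ → fire r D ⊆ˡ fire r D′
  fire-mono nothing          D⊆D′ = D⊆D′
  fire-mono (just (n₀ , ns)) {D} {D′} D⊆D′ with all? (_∈? D) ns | all? (_∈? D′) ns
  ... | yes _    | yes _    = ∷⁺ʳ n₀ D⊆D′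
  ... | yes ns⊆D | no ns⊈D′ = contradiction (All.map D⊆D′ ns⊆D) ns⊈D′
  ... | no  _    | yes _    = ⊆-trans D⊆D′ (xs⊆x∷xs D′ n₀)
  ... | no  _    | no  _    = D⊆D′

  fire-conclusion : ∀ {n₀ ns D} → All (_∈ D) ns → n₀ ∈ fire (just (n₀ , ns)) D
  fire-conclusion {ns = ns} {D} ns⊆D with all? (_∈? D) ns
  ... | yes _    = here refl
  ... | no ns⊈D = contradiction ns⊆D ns⊈D

  All-fire : ∀ {Z D} → IsPoint e Z → ∀ m → All Z D → All Z (fire (e m) D)
  All-fire {D = D} Z-point m ZD with e m in em
  ... | nothing = ZD
  ... | just (n₀ , ns) with all? (_∈? D) ns
  ...   | yes ns⊆D = Z-point n₀ ns (m , em) (All.map (All.lookup ZD) ns⊆D) ∷ ZD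
  ...   | no  _    = ZD

  close : List ℕ → List ℕ → List ℕ
  close D []       = D
  close D (m ∷ ms) = close (fire (e m) D) ms

  close-++ : ∀ D ms ms′ → close D (ms ++ ms′) ≡ close (close D ms) ms′
  close-++ D []       ms′ = refl
  close-++ D (m ∷ ms) ms′ = close-++ (fire (e m) D) ms ms′

  close-⊇ : ∀ D ms → D ⊆ˡ close D ms
  close-⊇ D []       = ⊆-refl
  close-⊇ D (m ∷ ms) = ⊆-trans (fire-⊇ (e m) D) (close-⊇ (fire (e m) D) ms)

  close-mono : ∀ {D D′} ms → D ⊆ˡ D′ → close D ms ⊆ˡ close D′ ms
  close-mono []       D⊆D′ = D⊆D′
  close-mono (m ∷ ms) D⊆D′ = close-mono ms (fire-mono (e m) D⊆D′)

  All-close : ∀ {Z D} → IsPoint e Z → ∀ ms → All Z D → All Z (close D ms)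
  All-close Z-point []       ZD = ZD
  All-close Z-point (m ∷ ms) ZD = All-close Z-point ms (All-fire Z-point m ZD)

  close-++ˡ : ∀ H ms H′ ms′ → close H ms ⊆ˡ close (H ++ H′) (ms ++ ms′)
  close-++ˡ H ms H′ ms′ {x} x∈
    rewrite close-++ (H ++ H′) ms ms′
    = close-⊇ (close (H ++ H′) ms) ms′ (close-mono ms (xs⊆xs++ys H H′) x∈)

  close-++ʳ : ∀ H ms H′ ms′ → close H′ ms′ ⊆ˡ close (H ++ H′) (ms ++ ms′)
  close-++ʳ H ms H′ ms′ {x} x∈
    rewrite close-++ (H ++ H′) ms ms′
    = close-mono ms′ (⊆-trans (xs⊆ys++xs H′ H) (close-⊇ (H ++ H′) ms)) x∈

  Derivable : Subset → Subset
  Derivable Y x = ∃₂ λ H ms → All Y H × x ∈ close H ms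

  Derivable-⊇ : ∀ Y → Y ⊆ Derivable Y
  Derivable-⊇ Y y Yy = [ y ] , [] , Yy ∷ [] , here refl

  Derivable-least : ∀ {Y Z} → IsPoint e Z → Y ⊆ Z → Derivable Y ⊆ Z
  Derivable-least Z-point Y⊆Z x (H , ms , YH , x∈) =
    All.lookup (All-close Z-point ms (All.map (Y⊆Z _) YH)) x∈

  Derivable-All : ∀ {Y} ns → All (Derivable Y) ns → ∃₂ λ H ms → All Y H × All (_∈ close H ms) ns
  Derivable-All []       []                         = [] , [] , [] , []
  Derivable-All (n ∷ ns) ((H , ms , YH , n∈) ∷ dns) with Derivable-All ns dns
  ... | H′ , ms′ , YH′ , ns∈ =
    H ++ H′ , ms ++ ms′ , ++⁺ YH YH′ ,
    close-++ˡ H ms H′ ms′ n∈ ∷ All.map (close-++ʳ H ms H′ ms′) ns∈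

  Derivable-point : ∀ Y → IsPoint e (Derivable Y)
  Derivable-point Y n₀ ns (m , em) dns with Derivable-All ns dns
  ... | H , ms , YH , ns∈ = H , ms ++ [ m ] , YH , n₀∈
    where
    n₀∈ : n₀ ∈ close H (ms ++ [ m ])
    n₀∈ rewrite close-++ H ms [ m ] | em = fire-conclusion ns∈

  Derivable-presentation : ∀ Y → IsPresentation e (Derivable Y) Y
  Derivable-presentation Y =
    Derivable-point Y , Derivable-⊇ Y , λ Z Z-point Y⊆Z → Derivable-least Z-point Y⊆Z

  check : ℕ → List ℕ × List ℕ → Maybe (List ℕ)
  check x (H , ms) with x ∈? close H ms
  ... | yes _ = just H
  ... | no  _ = nothing

  check-⊆ᶠ : ∀ {Y} x H ms → check x (H , ms) ⊆ᶠ Y ⇔ (All Y H × x ∈ close H ms)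
  check-⊆ᶠ x H ms with x ∈? close H ms
  ... | yes x∈ = mk⇔ (_, x∈) proj₁
  ... | no  x∉ = mk⇔ ⊥-elim (x∉ ∘ proj₂)

  open Coding (×-coding List-coding List-coding)

  reduction : ℕ → ℕ → Maybe (List ℕ)
  reduction x = check x ∘ decode

  reduction⇔Derivable : ∀ Y x → (∃ λ n → reduction x n ⊆ᶠ Y) ⇔ Derivable Y x
  reduction⇔Derivable Y x = mk⇔
    (λ (n , reduced) → let H , ms = decode n in H , ms , Equivalence.to (check-⊆ᶠ x H ms) reduced)
    (λ (H , ms , derived) → encode (H , ms) ,
       subst (λ d → check x d ⊆ᶠ Y) (sym (decode-encode (H , ms))) (Equivalence.from (check-⊆ᶠ x H ms) derived))

  ≤e⇔IsPresentation : ∀ {X Y} → IsPoint e X → X ≤e[ reduction ] Y ⇔ IsPresentation e X Y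
  ≤e⇔IsPresentation {Y = Y} X-point =
    ⇔-sym (IsPresentation⇔≐ (Derivable-presentation Y) X-point) ⇔-∘
    mk⇔ (λ X≤Y x → reduction⇔Derivable Y x ⇔-∘ X≤Y x)
        (λ X≐D x → ⇔-sym (reduction⇔Derivable Y x) ⇔-∘ X≐D x)

mainTheorem2 : (e : Enumeration) →
    Σ (ℕ → ℕ → Maybe (List ℕ)) (λ f →
      ∀ (X Y : Subset) → IsPoint e X → (X ≤e[ f ] Y ⇔ IsPresentation e X Y))
    × (∀ (X : Subset) → FinitelyPresented e X → RecEnum X)
    × (∀ (X : Subset) → RecursivelyPresented e X → RecEnum X)
mainTheorem2 e =
    (reduction , λ X Y → ≤e⇔IsPresentation)
  , (λ X (l , presentation) → ≤e-RecEnum (reduces presentation) (RecEnum-∈ l))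
  , (λ X (g , presentation) → ≤e-RecEnum (reduces presentation) (g , λ _ → ⇔-id _))
  where
  open Derivations e

  reduces : ∀ {X Y} → IsPresentation e X Y → X ≤e[ reduction ] Y
  reduces presentation = Equivalence.from (≤e⇔IsPresentation (proj₁ presentation)) presentation
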